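{- Let $N=p_1^{2a_1}p_2^{2a_2}\cdots p_t^{2a_t}=m^2$, where $p_1,\ldots,p_t$ are distinct primes and $a_1,\ldots,a_t$ are positive integers. If $N$ is quasiperfect, then there exists an index $j$ such that $p_j\equiv 1\pmod{4}$ and $2a_j+1$ does not have a (positive) divisor congruent to $5\pmod{8}$. Moreover, if $N=(p_1p_2\cdots p_t)^{2a}=m^2$ is quasiperfect, where $p_1,\ldots,p_t$ are distinct primes and $a$ is a positive integer, then: (a) all prime factors of $N$ are congruent to $1$ or $7\pmod{8}$; (b) $2a+1\equiv 3\pmod{8}$ and all prime factors of $2a+1$ are congruent to $1$ or $3\pmod{8}$; (c) $2a+1$ is divisible by $3$.
   Context: $\sigma(N)$ denotes the sum of the positive divisors of $N$. A positive integer $N$ is called quasiperfect if $\sigma(N)=2N+1$. -}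

module Defs where

open import Data.Fin using (Fin)
open import Data.List using (applyUpTo; filter; tabulate)
open import Data.Nat using (ℕ; suc; _+_; _*_; _<_)
open import Data.Nat.Divisibility using (_∣?_)
open import Data.Nat.ListAction using (sum; product)
open import Data.Product using (_×_)
open import Relation.Binary.PropositionalEquality using (_≡_)

-- applyUpTo suc n is the list 1, 2, …, n.
σ : ℕ → ℕ
σ n = sum (filter (_∣? n) (applyUpTo suc n))

Quasiperfect : ℕ → Set
Quasiperfect n = 0 < n × σ n ≡ 2 * n + 1

∏ : ∀ {t} → (Fin t → ℕ) → ℕ
∏ f = product (tabulate f)

{-# OPTIONS --safe #-}
module Submission where

-- If d divides n then 1 + p + … + p^(d-1) divides 1 + p + … + p^(n-1). With n = 2aᵢ + 1 the latter
-- divides σ(N) = 2m² + 1, all of whose divisors are 1 or 3 mod 8, because -2 is a square modulo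
-- them. The geometric sums mod 8 depend only on p (odd) and d mod 8. As N is odd, σ(N) ≡ 3 (mod 8), so
-- some factor σ(pⱼ^(2aⱼ)) is 3 mod 8; this forces pⱼ ≡ 1 (mod 4), and then a divisor d ≡ 5 (mod 8)
-- of 2aⱼ + 1 would give a divisor of σ(N) that is 5 mod 8.
-- When all aᵢ = a, the residue 3 at pⱼ excludes primes pᵢ ≡ 3 (mod 8), in particular 3 ∤ N. Then
-- σ(N) = 2m² + 1 is divisible by 3, which forces 3 ∣ 2a + 1; hence 1 + pᵢ + pᵢ² divides σ(N), which
-- leaves only pᵢ ≡ 1, 7 (mod 8).

open import Defs
open import Data.Fin using (Fin; zero; suc)
open import Data.Fin.Properties using () renaming (suc-injective to Fin-suc-injective; 0≢1+n to zero≢suc)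
open import Data.List using (List; []; _∷_; _++_; map; filter; applyUpTo)
open import Data.List.Membership.Propositional using (_∈_)
open import Data.List.Membership.Propositional.Properties
  using (∈-filter⁺; ∈-filter⁻; ∈-applyUpTo⁺; ∈-map⁺; ∈-map⁻; ∈-++⁺ˡ; ∈-++⁺ʳ; ∈-++⁻; ∈-tabulate⁺)
open import Data.List.Membership.Propositional.Properties.WithK using (unique∧set⇒bag)
open import Data.List.Relation.Binary.BagAndSetEquality using (∼bag⇒↭)
open import Data.List.Relation.Binary.Permutation.Propositional using (_↭_)
open import Data.List.Relation.Unary.All.Properties using () renaming (tabulate⁺ to All-tabulate⁺)
open import Data.List.Relation.Unary.Unique.Propositional using (Unique)
import Data.List.Relation.Unary.Unique.Propositional.Properties as Unique
open import Data.Nat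
  using (ℕ; zero; suc; _+_; _*_; _∸_; _^_; _≤_; _<_; _%_; _/_; NonZero; _≟_; s≤s; ≢-nonZero)
open import Data.Nat.Divisibility
open import Data.Nat.DivMod
open import Data.Nat.Induction using (<-rec)
open import Data.Nat.ListAction using (sum)
open import Data.Nat.ListAction.Properties using (sum-++; sum-↭; ∈⇒∣product; product≢0)
open import Data.Nat.Primality using
  (Prime; prime?; prime[2]; ¬prime[1]; prime⇒nonZero; prime⇒irreducible; euclidsLemma)
open import Data.Nat.Properties
open import Data.Nat.Tactic.RingSolver using (solve-∀)
open import Data.Product using (_×_; _,_; ∃-syntax; proj₁; proj₂)
open import Data.Sum using (_⊎_; inj₁; inj₂; [_,_]′; reduce)
open import Function using (_∘_; id; mk⇔)
open import Function.Definitions using (Injective)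
open import Relation.Binary.PropositionalEquality
  using (_≡_; _≢_; refl; sym; trans; cong; cong₂; subst; subst₂; module ≡-Reasoning)
open import Relation.Nullary using (¬_; Dec; yes; no; contradiction)
open import Relation.Nullary.Decidable using (from-yes; _→-dec_; _⊎-dec_; _×-dec_; ¬?)

-- Divisor lists and the divisor sum at a prime power times a coprime factor.

divisors : ℕ → List ℕ
divisors n = filter (_∣? n) (applyUpTo suc n)

∈-divisors⁺ : ∀ {d n} .{{_ : NonZero n}} → d ∣ n → d ∈ divisors n
∈-divisors⁺ {zero}  {suc n} 0∣n = contradiction (0∣⇒≡0 0∣n) λ ()
∈-divisors⁺ {suc d} {n}     d∣n = ∈-filter⁺ (_∣? n) (∈-applyUpTo⁺ suc (∣⇒≤ d∣n)) d∣n

∈-divisors⁻ : ∀ n {d} → d ∈ divisors n → d ∣ n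
∈-divisors⁻ n = proj₂ ∘ ∈-filter⁻ (_∣? n) {xs = applyUpTo suc n}

divisors-unique : ∀ n → Unique (divisors n)
divisors-unique n = Unique.filter⁺ (_∣? n)
  (Unique.applyUpTo⁺₁ suc n λ i<j _ → <⇒≢ i<j ∘ suc-injective)

sum-map-* : ∀ c xs → sum (map (c *_) xs) ≡ c * sum xs
sum-map-* c []       = sym (*-zeroʳ c)
sum-map-* c (x ∷ xs) =
  trans (cong (c * x +_) (sum-map-* c xs)) (sym (*-distribˡ-+ c x (sum xs)))

-- Euclid's lemma on the cofactor `e`: `p` divides `e * d` but not `d`, so it divides `e` and can be
-- cancelled.
∣*∧∤⇒∣ : ∀ {p d m} → Prime p → p ∤ d → d ∣ p * m → d ∣ m
∣*∧∤⇒∣ {p} {d} {m} p-prime p∤d (divides e p*m≡e*d)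
  with euclidsLemma e d p-prime (divides m (trans (sym p*m≡e*d) (*-comm p m)))
... | inj₂ p∣d = contradiction p∣d p∤d
... | inj₁ (divides f refl) =
  divides f (*-cancelˡ-≡ m (f * d) p {{prime⇒nonZero p-prime}} (trans p*m≡e*d (lemma f p d)))
  where
  lemma : ∀ f p d → f * p * d ≡ p * (f * d)
  lemma = solve-∀

∣^*∧∤⇒∣ : ∀ {p d q} k → Prime p → p ∤ d → d ∣ p ^ k * q → d ∣ q
∣^*∧∤⇒∣ {d = d} {q} zero p-prime p∤d d∣ = subst (d ∣_) (*-identityˡ q) d∣
∣^*∧∤⇒∣ {p} {d} {q} (suc k) p-prime p∤d d∣ =
  ∣^*∧∤⇒∣ k p-prime p∤d (∣*∧∤⇒∣ p-prime p∤d (subst (d ∣_) (*-assoc p (p ^ k) q) d∣))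

prime^*≢0 : ∀ {p q} k → Prime p → .{{_ : NonZero q}} → NonZero (p ^ k * q)
prime^*≢0 {p} {q} k p-prime = m*n≢0 (p ^ k) q {{m^n≢0 p k {{prime⇒nonZero p-prime}}}}

-- A divisor prime to `p` already divides `q`; any other is `p` times a divisor of `p ^ k * q`. The
-- two cases are disjoint and all lists involved are duplicate-free, so having the same elements
-- makes them permutations of each other.
divisors-prime^*-↭ : ∀ {p q} k → Prime p → p ∤ q → .{{_ : NonZero q}} →
  divisors (p ^ suc k * q) ↭ divisors q ++ map (p *_) (divisors (p ^ k * q))
divisors-prime^*-↭ {p} {q} k p-prime p∤q =
  ∼bag⇒↭ (unique∧set⇒bag (divisors-unique (p ^ suc k * q)) unique (mk⇔ to from))
  where
  instance
    p≢0 = prime⇒nonZero p-prime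
    p^k*q≢0 = prime^*≢0 {p} {q} k p-prime
    p^1+k*q≢0 = prime^*≢0 {p} {q} (suc k) p-prime

  unique : Unique (divisors q ++ map (p *_) (divisors (p ^ k * q)))
  unique = Unique.++⁺ (divisors-unique q)
    (Unique.map⁺ (*-cancelˡ-≡ _ _ p) (divisors-unique (p ^ k * q)))
    λ (d∈ , d∈map) → let e , _ , d≡p*e = ∈-map⁻ (p *_) d∈map in
      p∤q (∣-trans (subst (p ∣_) (sym d≡p*e) (m∣m*n e)) (∈-divisors⁻ q d∈))

  to : ∀ {d} → d ∈ divisors (p ^ suc k * q) → d ∈ divisors q ++ map (p *_) (divisors (p ^ k * q))
  to {d} d∈ with p ∣? d
  ... | no p∤d = ∈-++⁺ˡ (∈-divisors⁺ (∣^*∧∤⇒∣ (suc k) p-prime p∤d (∈-divisors⁻ (p ^ suc k * q) d∈)))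
  ... | yes (divides e refl) = ∈-++⁺ʳ (divisors q) (subst (_∈ map (p *_) (divisors (p ^ k * q)))
    (*-comm p e)
    (∈-map⁺ (p *_) (∈-divisors⁺
      (*-cancelˡ-∣ p (subst₂ _∣_ (*-comm e p) (*-assoc p (p ^ k) q) (∈-divisors⁻ (p ^ suc k * q) d∈))))))

  from : ∀ {d} → d ∈ divisors q ++ map (p *_) (divisors (p ^ k * q)) → d ∈ divisors (p ^ suc k * q)
  from d∈ with ∈-++⁻ (divisors q) d∈
  ... | inj₁ d∈q = ∈-divisors⁺ (∣n⇒∣m*n (p ^ suc k) (∈-divisors⁻ q d∈q))
  ... | inj₂ d∈map with e , e∈ , refl ← ∈-map⁻ (p *_) d∈map =
    ∈-divisors⁺ (subst (p * e ∣_) (sym (*-assoc p (p ^ k) q)) (*-monoʳ-∣ p (∈-divisors⁻ (p ^ k * q) e∈)))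

-- The sum 1 + r + ... + r^(n-1) in Horner form, free of subtraction and division; for prime r it is
-- σ(r^(n-1)) when n > 0.
geom : ℕ → ℕ → ℕ
geom r zero    = 0
geom r (suc n) = 1 + r * geom r n

-- The splitting of the divisor list gives σ(p^(k+1) q) = σ(q) + p σ(p^k q), which is the Horner
-- recursion of `geom` scaled by `σ q`.
σ-prime^* : ∀ {p q} k → Prime p → p ∤ q → .{{_ : NonZero q}} →
  σ (p ^ k * q) ≡ geom p (suc k) * σ q
σ-prime^* {p} {q} zero p-prime p∤q = begin
  σ (1 * q)          ≡⟨ cong σ (*-identityˡ q) ⟩
  σ q                ≡⟨ *-identityˡ (σ q) ⟨
  1 * σ q            ≡⟨ cong (λ x → suc x * σ q) (*-zeroʳ p) ⟨
  geom p 1 * σ q     ∎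
  where open ≡-Reasoning
σ-prime^* {p} {q} (suc k) p-prime p∤q = begin
  σ (p ^ suc k * q)
    ≡⟨ sum-↭ (divisors-prime^*-↭ k p-prime p∤q) ⟩
  sum (divisors q ++ map (p *_) (divisors (p ^ k * q)))
    ≡⟨ sum-++ (divisors q) _ ⟩
  σ q + sum (map (p *_) (divisors (p ^ k * q)))
    ≡⟨ cong (σ q +_) (sum-map-* p (divisors (p ^ k * q))) ⟩
  σ q + p * σ (p ^ k * q)
    ≡⟨ cong (λ x → σ q + p * x) (σ-prime^* k p-prime p∤q) ⟩
  σ q + p * (geom p (suc k) * σ q)
    ≡⟨ cong (σ q +_) (*-assoc p (geom p (suc k)) (σ q)) ⟨
  geom p (suc (suc k)) * σ q ∎
  where open ≡-Reasoning

-- Prime factorizations and the value of σ on them.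

prime∣^⇒∣ : ∀ {q m} k → Prime q → q ∣ m ^ k → q ∣ m
prime∣^⇒∣ zero q-prime q∣1 = contradiction (subst Prime (∣1⇒≡1 q∣1) q-prime) ¬prime[1]
prime∣^⇒∣ {m = m} (suc k) q-prime q∣ =
  [ id , prime∣^⇒∣ k q-prime ]′ (euclidsLemma m (m ^ k) q-prime q∣)

prime∣prime⇒≡ : ∀ {q p} → Prime q → Prime p → q ∣ p → q ≡ p
prime∣prime⇒≡ q-prime p-prime q∣p with prime⇒irreducible p-prime q∣p
... | inj₁ refl = contradiction q-prime ¬prime[1]
... | inj₂ q≡p  = q≡p

prime∣∏ : ∀ {t q} (f : Fin t → ℕ) → Prime q → q ∣ ∏ f → ∃[ i ] q ∣ f i
prime∣∏ {zero} f q-prime q∣1 = contradiction (subst Prime (∣1⇒≡1 q∣1) q-prime) ¬prime[1]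
prime∣∏ {suc t} f q-prime q∣ with euclidsLemma (f zero) _ q-prime q∣
... | inj₁ q∣f0 = zero , q∣f0
... | inj₂ q∣∏  = let i , q∣fi = prime∣∏ (f ∘ suc) q-prime q∣∏ in suc i , q∣fi

prime∣∏^ : ∀ {t q} (p k : Fin t → ℕ) → (∀ i → Prime (p i)) → Prime q →
  q ∣ ∏ (λ i → p i ^ k i) → ∃[ i ] q ≡ p i
prime∣∏^ p k p-prime q-prime q∣ =
  let i , q∣p^k = prime∣∏ (λ i → p i ^ k i) q-prime q∣
  in i , prime∣prime⇒≡ q-prime (p-prime i) (prime∣^⇒∣ (k i) q-prime q∣p^k)

∣∏ : ∀ {t} (f : Fin t → ℕ) i → f i ∣ ∏ f
∣∏ f i = ∈⇒∣product (∈-tabulate⁺ i)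

^-distribʳ-* : ∀ m n k → (m * n) ^ k ≡ m ^ k * n ^ k
^-distribʳ-* m n zero    = refl
^-distribʳ-* m n (suc k) =
  trans (cong (m * n *_) (^-distribʳ-* m n k)) (lemma m n (m ^ k) (n ^ k))
  where
  lemma : ∀ m n a b → m * n * (a * b) ≡ m * a * (n * b)
  lemma = solve-∀

∏-^ : ∀ {t} (p : Fin t → ℕ) k → ∏ p ^ k ≡ ∏ (λ i → p i ^ k)
∏-^ {zero}  p k = ^-zeroˡ k
∏-^ {suc t} p k = trans (^-distribʳ-* (p zero) (∏ (p ∘ suc)) k) (cong (p zero ^ k *_) (∏-^ (p ∘ suc) k))

-- The prime powers are split off one at a time. A first prime dividing the rest would equal a later
-- one, against injectivity.
σ-∏^ : ∀ {t} (p k : Fin t → ℕ) → (∀ i → Prime (p i)) → Injective _≡_ _≡_ p →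
  σ (∏ (λ i → p i ^ k i)) ≡ ∏ (λ i → geom (p i) (k i + 1))
σ-∏^ {zero}  p k p-prime p-inj = refl
σ-∏^ {suc t} p k p-prime p-inj = trans
  (σ-prime^* (k zero) (p-prime zero) p₀∤rest {{rest≢0}})
  (cong₂ _*_ (cong (geom (p zero)) (+-comm 1 (k zero)))
    (σ-∏^ (p ∘ suc) (k ∘ suc) (p-prime ∘ suc) (Fin-suc-injective ∘ p-inj)))
  where
  p₀∤rest : p zero ∤ ∏ (λ i → p (suc i) ^ k (suc i))
  p₀∤rest p₀∣ with i , p₀≡ ← prime∣∏^ (p ∘ suc) (k ∘ suc) (p-prime ∘ suc) (p-prime zero) p₀∣ =
    zero≢suc (p-inj p₀≡)

  rest≢0 : NonZero (∏ (λ i → p (suc i) ^ k (suc i)))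
  rest≢0 = product≢0 (All-tabulate⁺ λ i → m^n≢0 (p (suc i)) (k (suc i)) {{prime⇒nonZero (p-prime (suc i))}})

-- Congruences and geometric sums modulo 8 and 3.

+-cong-% : ∀ {a b c d} m .{{_ : NonZero m}} → a % m ≡ b % m → c % m ≡ d % m → (a + c) % m ≡ (b + d) % m
+-cong-% {a} {b} {c} {d} m a≡b c≡d = begin
  (a + c) % m          ≡⟨ %-distribˡ-+ a c m ⟩
  (a % m + c % m) % m  ≡⟨ cong₂ (λ x y → (x + y) % m) a≡b c≡d ⟩
  (b % m + d % m) % m  ≡⟨ %-distribˡ-+ b d m ⟨
  (b + d) % m          ∎
  where open ≡-Reasoning

*-cong-% : ∀ {a b c d} m .{{_ : NonZero m}} → a % m ≡ b % m → c % m ≡ d % m → (a * c) % m ≡ (b * d) % m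
*-cong-% {a} {b} {c} {d} m a≡b c≡d = begin
  (a * c) % m              ≡⟨ %-distribˡ-* a c m ⟩
  ((a % m) * (c % m)) % m  ≡⟨ cong₂ (λ x y → (x * y) % m) a≡b c≡d ⟩
  ((b % m) * (d % m)) % m  ≡⟨ %-distribˡ-* b d m ⟨
  (b * d) % m              ∎
  where open ≡-Reasoning

odd-% : ∀ n → 2 ∤ n → n % 2 ≡ 1
odd-% n 2∤n with n % 2 in eq | m%n<n n 2
... | 0           | _             = contradiction (m%n≡0⇒n∣m n 2 eq) 2∤n
... | 1           | _             = refl
... | suc (suc _) | s≤s (s≤s ())

odd-%8 : ∀ n → 2 ∤ n → n % 8 % 2 ≡ 1
odd-%8 n = trans (m∣n⇒o%n%m≡o%m 2 8 n (divides 4 refl)) ∘ odd-% n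

geom-+ : ∀ r m n → geom r (m + n) ≡ geom r m + r ^ m * geom r n
geom-+ r zero    n = sym (*-identityˡ (geom r n))
geom-+ r (suc m) n = trans (cong (λ x → 1 + r * x) (geom-+ r m n)) (lemma r (geom r m) (r ^ m) (geom r n))
  where
  lemma : ∀ r x y z → 1 + r * (x + y * z) ≡ 1 + r * x + r * y * z
  lemma = solve-∀

-- Cutting the sum into blocks of `d` terms, each block is a power of `r` times `geom r d`.
geom-∣ : ∀ r {d n} → d ∣ n → geom r d ∣ geom r n
geom-∣ r {d} (divides zero    refl) = geom r d ∣0
geom-∣ r {d} (divides (suc q) refl) = subst (geom r d ∣_) (sym (geom-+ r d (q * d)))
  (∣m∣n⇒∣m+n ∣-refl (∣n⇒∣m*n (r ^ d) (geom-∣ r (divides q refl))))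

geom-% : ∀ r n m .{{_ : NonZero m}} → geom r n % m ≡ geom (r % m) n % m
geom-% r zero    m = refl
geom-% r (suc n) m = +-cong-% {1} {1} m refl (*-cong-% m (sym (m%n%n≡m%n r m)) (geom-% r n m))

geom-periodic : ∀ r c n m .{{_ : NonZero c}} .{{_ : NonZero m}} →
  geom r c % m ≡ 0 → r ^ c % m ≡ 1 % m → geom r n % m ≡ geom r (n % c) % m
geom-periodic r c n m gc≡0 r^c≡1 = trans
  (cong (λ x → geom r x % m) (trans (m≡m%n+[m/n]*n n c) (+-comm (n % c) _)))
  (drop-periods (n / c))
  where
  open ≡-Reasoning
  s = n % c
  drop-periods : ∀ q → geom r (q * c + s) % m ≡ geom r s % m
  drop-periods zero    = refl
  drop-periods (suc q) = begin
    geom r (c + q * c + s) % m                        ≡⟨ cong (λ x → geom r x % m) (+-assoc c (q * c) s) ⟩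
    geom r (c + (q * c + s)) % m                      ≡⟨ cong (_% m) (geom-+ r c (q * c + s)) ⟩
    (geom r c + r ^ c * geom r (q * c + s)) % m       ≡⟨ +-cong-% m (trans gc≡0 (sym (0%m m))) (*-cong-% m r^c≡1 (drop-periods q)) ⟩
    (0 + 1 * geom r s) % m                            ≡⟨ cong (_% m) (*-identityˡ (geom r s)) ⟩
    geom r s % m                                      ∎
    where
    0%m : ∀ m .{{_ : NonZero m}} → 0 % m ≡ 0
    0%m (suc _) = refl

-- Evaluation shows that 8 is a period for every odd residue. It is the least one for residue 1,
-- where the sum counts its terms.
geom-mod-8 : ∀ {r} n → 2 ∤ r → geom r n % 8 ≡ geom (r % 8) (n % 8) % 8
geom-mod-8 {r} n r-odd = trans (geom-% r n 8)
  (geom-periodic (r % 8) 8 n 8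
    (from-yes (allUpTo? (λ s → s % 2 ≟ 1 →-dec geom s 8 % 8 ≟ 0) 8) (m%n<n r 8) (odd-%8 r r-odd))
    (from-yes (allUpTo? (λ s → s % 2 ≟ 1 →-dec s ^ 8 % 8 ≟ 1) 8) (m%n<n r 8) (odd-%8 r r-odd)))

-- The period 6 serves both nonzero residues: for 1 the sum is `n` (period 3), for 2 the sums
-- alternate between 0 and 1 (period 2).
geom-mod-3 : ∀ {r} n → r % 3 ≢ 0 → geom r n % 3 ≡ geom (r % 3) (n % 6) % 3
geom-mod-3 {r} n r≢0 = trans (geom-% r n 3)
  (geom-periodic (r % 3) 6 n 3
    (from-yes (allUpTo? (λ s → ¬? (s ≟ 0) →-dec geom s 6 % 3 ≟ 0) 3) (m%n<n r 3) r≢0)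
    (from-yes (allUpTo? (λ s → ¬? (s ≟ 0) →-dec s ^ 6 % 3 ≟ 1) 3) (m%n<n r 3) r≢0))

-- For `r` ≡ 1 (mod 3) the sum is congruent to `n`; for `r` ≡ 2 an odd number of terms sums to 1,
-- which 3 does not divide. The residue of `n` modulo 6 carries both its parity and its residue
-- modulo 3.
3∣geom⇒3∣ : ∀ {r n} → 3 ∤ r → 2 ∤ n → 3 ∣ geom r n → 3 ∣ n
3∣geom⇒3∣ {r} {n} 3∤r n-odd 3∣g = m%n≡0⇒n∣m n 3 (trans (sym (m∣n⇒o%n%m≡o%m 3 6 n (divides 2 refl)))
  (from-yes
    (allUpTo? (λ s → allUpTo? (λ c →
      ¬? (s ≟ 0) →-dec c % 2 ≟ 1 →-dec geom s c % 3 ≟ 0 →-dec c % 3 ≟ 0) 6) 3)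
    (m%n<n r 3) (m%n<n n 6) r≢0
    (trans (m∣n⇒o%n%m≡o%m 2 6 n (divides 3 refl)) (odd-% n n-odd))
    (trans (sym (geom-mod-3 n r≢0)) (n∣m⇒m%n≡0 _ 3 3∣g))))
  where
  r≢0 : r % 3 ≢ 0
  r≢0 = 3∤r ∘ m%n≡0⇒n∣m r 3

-- Odd divisors of x² + 2.

OneOrThree : ℕ → Set
OneOrThree n = n ≡ 1 ⊎ n ≡ 3

oneOrThree? : ∀ n → Dec (OneOrThree n)
oneOrThree? n = n ≟ 1 ⊎-dec n ≟ 3

x²+2-mod-8 : ∀ x → 2 ∤ x → (x * x + 2) % 8 ≡ 3
x²+2-mod-8 x x-odd = trans
  (+-cong-% {x * x} {x % 8 * (x % 8)} {2} {2} 8 (%-distribˡ-* x x 8) refl)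
  (from-yes (allUpTo? (λ s → s % 2 ≟ 1 →-dec ((s * s) + 2) % 8 ≟ 3) 8) (m%n<n x 8) (odd-%8 x x-odd))

odd-∣2⇒≡1 : ∀ {d} → 2 ∤ d → d ∣ 2 → d ≡ 1
odd-∣2⇒≡1 2∤d d∣2 with prime⇒irreducible prime[2] d∣2
... | inj₁ d≡1  = d≡1
... | inj₂ refl = contradiction ∣-refl 2∤d

-- Fermat descent: if y < d is odd and y² + 2 = e * d, then e < d is again an odd divisor of y² + 2,
-- and e * d ≡ 3 (mod 8).
∣x²+2⇒oneOrThree : ∀ d x → 2 ∤ d → d ∣ x * x + 2 → OneOrThree (d % 8)
∣x²+2⇒oneOrThree = <-rec (λ d → ∀ x → 2 ∤ d → d ∣ x * x + 2 → OneOrThree (d % 8)) step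
  where
  module _ (d : ℕ) (rec : ∀ {e} → e < d → ∀ x → 2 ∤ e → e ∣ x * x + 2 → OneOrThree (e % 8)) where

    descend : ∀ y → y < d → 2 ∤ y → d ∣ y * y + 2 → OneOrThree (d % 8)
    descend y y<d y-odd (divides e y²+2≡e*d) =
      -- If `e` is 1 or 3 modulo 8, then `e * d` ≡ 3 leaves 3 or 1, respectively, for `d`.
      from-yes (allUpTo? (λ s → allUpTo? (λ u →
          oneOrThree? u →-dec (u * s) % 8 ≟ 3 →-dec oneOrThree? s) 8) 8)
        (m%n<n d 8) (m%n<n e 8) (rec e<d y e-odd e∣y²+2)
        (trans (sym (%-distribˡ-* e d 8)) e*d≡3)
      where
      e∣y²+2 : e ∣ y * y + 2
      e∣y²+2 = divides d (trans y²+2≡e*d (*-comm e d))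

      e*d≡3 : (e * d) % 8 ≡ 3
      e*d≡3 = trans (cong (_% 8) (sym y²+2≡e*d)) (x²+2-mod-8 y y-odd)

      e-odd : 2 ∤ e
      e-odd 2∣e = y-odd (reduce (euclidsLemma y y prime[2]
        (∣m+n∣m⇒∣n (subst (2 ∣_) (+-comm (y * y) 2) (∣-trans 2∣e e∣y²+2)) ∣-refl)))

      -- Positivity gives 2 < 2y + 1, so that y² + 2 < (y + 1)² ≤ d² and the descent is strict.
      1≤y : 1 ≤ y
      1≤y = n≢0⇒n>0 λ { refl → y-odd (2 ∣0) }

      e<d : e < d
      e<d = *-cancelʳ-< d e d (begin-strict
        e * d             ≡⟨ y²+2≡e*d ⟨
        y * y + 2         <⟨ +-monoʳ-< (y * y) (s≤s (*-monoʳ-≤ 2 1≤y)) ⟩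
        y * y + suc (2 * y) ≡⟨ lemma y ⟩
        suc y * suc y     ≤⟨ *-mono-≤ y<d y<d ⟩
        d * d             ∎)
        where
        open ≤-Reasoning
        lemma : ∀ y → y * y + suc (2 * y) ≡ suc y * suc y
        lemma = solve-∀

    step : ∀ x → 2 ∤ d → d ∣ x * x + 2 → OneOrThree (d % 8)
    step x d-odd d∣x²+2 = go (2 ∣? r)
      where
      instance
        d≢0 : NonZero d
        d≢0 = ≢-nonZero λ { refl → d-odd (2 ∣0) }

      r = x % d

      d∣r²+2 : d ∣ r * r + 2
      d∣r²+2 = ∣m+n∣m⇒∣n (subst (d ∣_) (trans (cong (λ z → z * z + 2) (m≡m%n+[m/n]*n x d)) (lemma r (x / d) d)) d∣x²+2)
        (m∣m*n (x / d * (r + r + x / d * d)))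
        where
        lemma : ∀ r q d → (r + q * d) * (r + q * d) + 2 ≡ d * (q * (r + r + q * d)) + (r * r + 2)
        lemma = solve-∀

      go : Dec (2 ∣ r) → OneOrThree (d % 8)
      go (no r-odd) = descend r (m%n<n x d) r-odd d∣r²+2
      -- An even remainder is replaced by `d ∸ r`, odd because `d` is. Remainder 0 is set apart, as
      -- `d ∸ r` would not be below `d`; there `d` divides 2 and equals 1.
      go (yes 2∣r) with r ≟ 0
      ... | yes r≡0 = inj₁ (cong (_% 8) (odd-∣2⇒≡1 d-odd (subst (λ z → d ∣ z * z + 2) r≡0 d∣r²+2)))
      ... | no r≢0 = descend y y<d y-odd d∣y²+2
        where
        y = d ∸ r
        r+y≡d : r + y ≡ d
        r+y≡d = m+[n∸m]≡n (m%n≤n x d)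

        y<d : y < d
        y<d = ∸-monoʳ-< (n≢0⇒n>0 r≢0) (m%n≤n x d)

        y-odd : 2 ∤ y
        y-odd 2∣y = d-odd (subst (2 ∣_) r+y≡d (∣m∣n⇒∣m+n 2∣r 2∣y))

        -- This is y ≡ -r (mod d), hence y² ≡ r²; adding `d * y` and `d * r` to the two sides avoids
        -- subtraction.
        d∣y²+2 : d ∣ y * y + 2
        d∣y²+2 = ∣m+n∣m⇒∣n
          (subst (d ∣_) (trans (cong (λ z → z * y + (r * r + 2)) (sym r+y≡d))
             (trans (lemma r y) (cong (λ z → z * r + (y * y + 2)) r+y≡d)))
            (∣m∣n⇒∣m+n (m∣m*n y) d∣r²+2))
          (m∣m*n r)
          where
          lemma : ∀ r y → (r + y) * y + (r * r + 2) ≡ (r + y) * r + (y * y + 2)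
          lemma = solve-∀

-- Doubling 2x² + 1 gives (2x)² + 2, and a divisor of the odd number 2x² + 1 is odd.
∣2x²+1⇒oneOrThree : ∀ {d} x → d ∣ 2 * (x * x) + 1 → OneOrThree (d % 8)
∣2x²+1⇒oneOrThree {d} x d∣ = ∣x²+2⇒oneOrThree d (2 * x)
  (λ 2∣d → contradiction (∣1⇒≡1 (∣m+n∣m⇒∣n (∣-trans 2∣d d∣) (m∣m*n (x * x)))) λ ())
  (subst (d ∣_) (lemma x) (∣n⇒∣m*n 2 d∣))
  where
  lemma : ∀ x → 2 * (2 * (x * x) + 1) ≡ 2 * x * (2 * x) + 2
  lemma = solve-∀

-- Residue facts for products and geometric sums.

geom-2-mod-8 : ∀ k → geom 2 (3 + k) % 8 ≡ 7
geom-2-mod-8 k = trans (cong (_% 8) (lemma (geom 2 k))) ([m+kn]%n≡m%n 7 (geom 2 k) 8)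
  where
  lemma : ∀ g → 1 + 2 * (1 + 2 * (1 + 2 * g)) ≡ 7 + g * 8
  lemma = solve-∀

∏≢1⇒∃≢1 : ∀ {t} (f : Fin t → ℕ) m .{{_ : NonZero m}} → ∏ f % m ≢ 1 % m → ∃[ i ] f i % m ≢ 1 % m
∏≢1⇒∃≢1 {zero}  f m ∏≢1 = contradiction refl ∏≢1
∏≢1⇒∃≢1 {suc t} f m ∏≢1 with f zero % m ≟ 1 % m
... | no  f₀≢1 = zero , f₀≢1
... | yes f₀≡1 =
  let i , fᵢ≢1 = ∏≢1⇒∃≢1 (f ∘ suc) m λ rest≡1 → ∏≢1 (*-cong-% {f zero} {1} {_} {1} m f₀≡1 rest≡1)
  in suc i , fᵢ≢1

2x²+1-mod : ∀ x m .{{_ : NonZero m}} → (2 * (x * x) + 1) % m ≡ (2 * (x % m * (x % m)) + 1) % m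
2x²+1-mod x m = +-cong-% {2 * (x * x)} {2 * (x % m * (x % m))} {1} m
  (*-cong-% {2} {2} {x * x} m refl (%-distribˡ-* x x m)) refl

-- For `r` ≡ 3 (mod 4) the sums alternate between 0 and 1 modulo 4, so they are never 3 modulo 8.
geom≡3⇒≡1-mod-4 : ∀ {r} → r < 8 → ∀ {c} → c < 8 → r % 2 ≡ 1 → geom r c % 8 ≡ 3 → r % 4 ≡ 1
geom≡3⇒≡1-mod-4 = from-yes (allUpTo? (λ r → allUpTo? (λ c →
  r % 2 ≟ 1 →-dec geom r c % 8 ≟ 3 →-dec r % 4 ≟ 1) 8) 8)

-- For both residues concerned, 1 and 5, five terms sum to 5 modulo 8.
geom-5-not-oneOrThree : ∀ {r} → r < 8 → r % 4 ≡ 1 → ¬ OneOrThree (geom r 5 % 8)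
geom-5-not-oneOrThree =
  from-yes (allUpTo? (λ r → r % 4 ≟ 1 →-dec ¬? (oneOrThree? (geom r 5 % 8))) 8)

-- The value 3 occurs only at `r` = 1, `c` = 3 and at `r` = 5, `c` = 7; in both cases `geom 3 c` ≡ 5
-- (mod 8).
geom≡3⇒geom-3-not-oneOrThree : ∀ {r} → r < 8 → ∀ {c} → c < 8 →
  r % 2 ≡ 1 → geom r c % 8 ≡ 3 → ¬ OneOrThree (geom 3 c % 8)
geom≡3⇒geom-3-not-oneOrThree = from-yes (allUpTo? (λ r → allUpTo? (λ c →
  r % 2 ≟ 1 →-dec geom r c % 8 ≟ 3 →-dec ¬? (oneOrThree? (geom 3 c % 8))) 8) 8)

-- For `r` = 1, 3, 5, 7 the sum 1 + r + r² is 3, 5, 7, 1 modulo 8.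
geom-3-oneOrThree⇒1⊎7 : ∀ {r} → r < 8 → r % 2 ≡ 1 → OneOrThree (geom r 3 % 8) → r ≡ 1 ⊎ r ≡ 7
geom-3-oneOrThree⇒1⊎7 = from-yes (allUpTo? (λ r →
  r % 2 ≟ 1 →-dec oneOrThree? (geom r 3 % 8) →-dec (r ≟ 1 ⊎-dec r ≟ 7)) 8)

-- With `r` = 7 the sums alternate between 0 and 1 modulo 8, and with `r` = 1 the sum is `c` itself.
geom≡3⇒1×3 : ∀ {r} → r < 8 → ∀ {c} → c < 8 → r ≡ 1 ⊎ r ≡ 7 → geom r c % 8 ≡ 3 → r ≡ 1 × c ≡ 3
geom≡3⇒1×3 = from-yes (allUpTo? (λ r → allUpTo? (λ c →
  (r ≟ 1 ⊎-dec r ≟ 7) →-dec geom r c % 8 ≟ 3 →-dec (r ≟ 1 ×-dec c ≟ 3)) 8) 8)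

geom-1-oneOrThree⇒oneOrThree : ∀ {c} → c < 8 → OneOrThree (geom 1 c % 8) → OneOrThree c
geom-1-oneOrThree⇒oneOrThree =
  from-yes (allUpTo? (λ c → oneOrThree? (geom 1 c % 8) →-dec oneOrThree? c) 8)

-- Quasiperfect squares with arbitrary exponents.

module QuasiperfectSquare
  {t : ℕ} (p a : Fin t → ℕ) (N m : ℕ)
  (p-prime : ∀ i → Prime (p i)) (p-injective : Injective _≡_ _≡_ p) (a>0 : ∀ i → 0 < a i)
  (N≡∏ : N ≡ ∏ (λ i → p i ^ (2 * a i))) (N≡m² : N ≡ m ^ 2) (N-quasiperfect : Quasiperfect N)
  where

  n : Fin t → ℕ
  n i = 2 * a i + 1

  σN≡∏ : σ N ≡ ∏ (λ i → geom (p i) (n i))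
  σN≡∏ = trans (cong σ N≡∏) (σ-∏^ p (λ i → 2 * a i) p-prime p-injective)

  σN≡2m²+1 : σ N ≡ 2 * (m * m) + 1
  σN≡2m²+1 = trans (proj₂ N-quasiperfect)
    (cong (λ x → 2 * x + 1) (trans N≡m² (cong (m *_) (*-identityʳ m))))

  prime∣N⇒≡p : ∀ {q} → Prime q → q ∣ N → ∃[ i ] q ≡ p i
  prime∣N⇒≡p {q} q-prime q∣N = prime∣∏^ p (λ i → 2 * a i) p-prime q-prime (subst (q ∣_) N≡∏ q∣N)

  ∤N⇒∤m : ∀ {q} → q ∤ N → q ∤ m
  ∤N⇒∤m {q} q∤N q∣m = q∤N (subst (q ∣_) (sym N≡m²) (∣m⇒∣m*n (m * 1) q∣m))

  geom-oneOrThree : ∀ i {d} → d ∣ n i → OneOrThree (geom (p i) d % 8)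
  geom-oneOrThree i {d} d∣n = ∣2x²+1⇒oneOrThree m (subst (geom (p i) d ∣_) (trans (sym σN≡∏) σN≡2m²+1)
    (∣-trans (geom-∣ (p i) d∣n) (∣∏ (λ i → geom (p i) (n i)) i)))

  -- Since `a i` is positive, the factor at 2 would have at least three terms and be 7 modulo 8, as
  -- 1 + 2 + 4 = 7 and all later terms vanish.
  p≢2 : ∀ i → p i ≢ 2
  p≢2 i pᵢ≡2 with a i | a>0 i | geom-oneOrThree i ∣-refl
  ... | suc b | _ | residue = [ (λ ()) , (λ ()) ]′ (subst OneOrThree
    (trans (cong₂ (λ r k → geom r k % 8) pᵢ≡2 (lemma b)) (geom-2-mod-8 (2 * b))) residue)
    where
    lemma : ∀ b → 2 * suc b + 1 ≡ 3 + 2 * b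
    lemma = solve-∀

  p-odd : ∀ i → 2 ∤ p i
  p-odd i 2∣p = p≢2 i (sym (prime∣prime⇒≡ prime[2] (p-prime i) 2∣p))

  n-odd : ∀ i → 2 ∤ n i
  n-odd i 2∣n = contradiction (∣1⇒≡1 (∣m+n∣m⇒∣n 2∣n (m∣m*n (a i)))) λ ()

  m-odd : 2 ∤ m
  m-odd = ∤N⇒∤m λ 2∣N → let i , 2≡p = prime∣N⇒≡p prime[2] 2∣N in p≢2 i (sym 2≡p)

  σN-mod-8 : σ N % 8 ≡ 3
  σN-mod-8 = trans (cong (_% 8) σN≡2m²+1) (trans (2x²+1-mod m 8)
    (from-yes (allUpTo? (λ s → s % 2 ≟ 1 →-dec (2 * (s * s) + 1) % 8 ≟ 3) 8) (m%n<n m 8) (odd-%8 m m-odd)))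

  residues-oneOrThree : ∀ i {d} → d ∣ n i → OneOrThree (geom (p i % 8) (d % 8) % 8)
  residues-oneOrThree i {d} d∣n = subst OneOrThree (geom-mod-8 d (p-odd i)) (geom-oneOrThree i d∣n)

  -- The product `σ N` is 3, not 1, modulo 8, so some factor is not 1; being 1 or 3, it is 3.
  ∃-geom≡3 : ∃[ j ] geom (p j % 8) (n j % 8) % 8 ≡ 3
  ∃-geom≡3 = j , trans (sym (geom-mod-8 (n j) (p-odd j)))
    ([ (λ g≡1 → contradiction g≡1 (proj₂ ∃-geom≢1)) , id ]′ (geom-oneOrThree j ∣-refl))
    where
    ∏≢1 : ∏ (λ i → geom (p i) (n i)) % 8 ≢ 1
    ∏≢1 ∏≡1 = contradiction (trans (sym σN-mod-8) (trans (cong (_% 8) σN≡∏) ∏≡1)) λ ()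

    ∃-geom≢1 : ∃[ i ] geom (p i) (n i) % 8 ≢ 1
    ∃-geom≢1 = ∏≢1⇒∃≢1 (λ i → geom (p i) (n i)) 8 ∏≢1

    j : Fin t
    j = proj₁ ∃-geom≢1

  geom≡3⇒p≡1-mod-4 : ∀ j → geom (p j % 8) (n j % 8) % 8 ≡ 3 → p j % 4 ≡ 1
  geom≡3⇒p≡1-mod-4 j g≡3 = trans (sym (m∣n⇒o%n%m≡o%m 4 8 (p j) (divides 2 refl)))
    (geom≡3⇒≡1-mod-4 (m%n<n (p j) 8) (m%n<n (n j) 8) (odd-%8 (p j) (p-odd j)) g≡3)

  ∃-no-divisor≡5 : ∃[ j ] (p j % 4 ≡ 1 × ¬ (∃[ d ] (d ∣ n j × d % 8 ≡ 5)))
  ∃-no-divisor≡5 = j , p≡1 , λ (d , d∣n , d≡5) →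
    geom-5-not-oneOrThree (m%n<n (p j) 8) (trans (m∣n⇒o%n%m≡o%m 4 8 (p j) (divides 2 refl)) p≡1)
      (subst (λ c → OneOrThree (geom (p j % 8) c % 8)) d≡5 (residues-oneOrThree j d∣n))
    where
    j : Fin t
    j = proj₁ ∃-geom≡3

    p≡1 : p j % 4 ≡ 1
    p≡1 = geom≡3⇒p≡1-mod-4 j (proj₂ ∃-geom≡3)

-- Quasiperfect numbers with all exponents equal.

module QuasiperfectPower
  {t : ℕ} (p : Fin t → ℕ) (a N m : ℕ)
  (p-prime : ∀ i → Prime (p i)) (p-injective : Injective _≡_ _≡_ p) (a>0 : 0 < a)
  (N≡∏^ : N ≡ ∏ p ^ (2 * a)) (N≡m² : N ≡ m ^ 2) (N-quasiperfect : Quasiperfect N)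
  where

  open QuasiperfectSquare p (λ _ → a) N m p-prime p-injective (λ _ → a>0)
    (trans N≡∏^ (∏-^ p (2 * a))) N≡m² N-quasiperfect

  j : Fin t
  j = proj₁ ∃-geom≡3

  geom-j≡3 : geom (p j % 8) ((2 * a + 1) % 8) % 8 ≡ 3
  geom-j≡3 = proj₂ ∃-geom≡3

  -- All factors share the length `2 * a + 1`, so the residue that `p j` forces on it also governs
  -- the factor at 3, which would be 5 modulo 8.
  p≢3 : ∀ i → p i ≢ 3
  p≢3 i pᵢ≡3 = geom≡3⇒geom-3-not-oneOrThree
    (m%n<n (p j) 8) (m%n<n (2 * a + 1) 8) (odd-%8 (p j) (p-odd j)) geom-j≡3
    (subst (λ x → OneOrThree (geom (x % 8) ((2 * a + 1) % 8) % 8)) pᵢ≡3 (residues-oneOrThree i ∣-refl))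

  prime[3] : Prime 3
  prime[3] = from-yes (prime? 3)

  3∤m : 3 ∤ m
  3∤m = ∤N⇒∤m λ 3∣N → let i , 3≡p = prime∣N⇒≡p prime[3] 3∣N in p≢3 i (sym 3≡p)

  -- As 3 does not divide `m`, m² ≡ 1 and 2m² + 1 ≡ 0 (mod 3).
  3∣σN : 3 ∣ σ N
  3∣σN = m%n≡0⇒n∣m (σ N) 3 (trans (cong (_% 3) σN≡2m²+1) (trans (2x²+1-mod m 3)
    (from-yes (allUpTo? (λ s → ¬? (s ≟ 0) →-dec (2 * (s * s) + 1) % 3 ≟ 0) 3)
      (m%n<n m 3) (3∤m ∘ m%n≡0⇒n∣m m 3))))

  -- The prime 3 divides one of the factors of `σ N`, a geometric sum of odd length whose base is a
  -- prime other than 3.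
  3∣2a+1 : 3 ∣ 2 * a + 1
  3∣2a+1 =
    let i , 3∣g = prime∣∏ (λ i → geom (p i) (2 * a + 1)) prime[3] (subst (3 ∣_) σN≡∏ 3∣σN) in
    3∣geom⇒3∣ {p i} (λ 3∣p → p≢3 i (sym (prime∣prime⇒≡ prime[3] (p-prime i) 3∣p))) (n-odd i) 3∣g

  p-mod-8 : ∀ i → p i % 8 ≡ 1 ⊎ p i % 8 ≡ 7
  p-mod-8 i = geom-3-oneOrThree⇒1⊎7 (m%n<n (p i) 8) (odd-%8 (p i) (p-odd i)) (residues-oneOrThree i 3∣2a+1)

  prime∣N-mod-8 : ∀ q → Prime q → q ∣ N → q % 8 ≡ 1 ⊎ q % 8 ≡ 7
  prime∣N-mod-8 q q-prime q∣N =
    let i , q≡p = prime∣N⇒≡p q-prime q∣N in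
    subst (λ x → x % 8 ≡ 1 ⊎ x % 8 ≡ 7) (sym q≡p) (p-mod-8 i)

  pⱼ≡1×2a+1≡3 : p j % 8 ≡ 1 × (2 * a + 1) % 8 ≡ 3
  pⱼ≡1×2a+1≡3 = geom≡3⇒1×3 (m%n<n (p j) 8) (m%n<n (2 * a + 1) 8) (p-mod-8 j) geom-j≡3

  -- Since p j ≡ 1 (mod 8), geom (p j) d ≡ d (mod 8).
  ∣2a+1⇒oneOrThree : ∀ {d} → d ∣ 2 * a + 1 → d % 8 ≡ 1 ⊎ d % 8 ≡ 3
  ∣2a+1⇒oneOrThree {d} d∣ = geom-1-oneOrThree⇒oneOrThree (m%n<n d 8)
    (subst (λ r → OneOrThree (geom r (d % 8) % 8)) (proj₁ pⱼ≡1×2a+1≡3) (residues-oneOrThree j d∣))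

theorem1p1 : (∀ (t : ℕ) (p a : Fin t → ℕ) (N m : ℕ) →
    (∀ i → Prime (p i)) → Injective _≡_ _≡_ p → (∀ i → 0 < a i) →
    N ≡ ∏ (λ i → p i ^ (2 * a i)) → N ≡ m ^ 2 →
    Quasiperfect N →
    ∃[ j ] (p j % 4 ≡ 1 × ¬ (∃[ d ] (d ∣ 2 * a j + 1 × d % 8 ≡ 5))))
    ×
    (∀ (t : ℕ) (p : Fin t → ℕ) (a N m : ℕ) →
    (∀ i → Prime (p i)) → Injective _≡_ _≡_ p → 0 < a →
    N ≡ ∏ p ^ (2 * a) → N ≡ m ^ 2 →
    Quasiperfect N →
    (∀ q → Prime q → q ∣ N → q % 8 ≡ 1 ⊎ q % 8 ≡ 7)
    × ((2 * a + 1) % 8 ≡ 3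
    × (∀ q → Prime q → q ∣ 2 * a + 1 → q % 8 ≡ 1 ⊎ q % 8 ≡ 3))
    × 3 ∣ 2 * a + 1)
theorem1p1 =
  (λ t p a N m p-prime p-injective a>0 N≡∏ N≡m² N-quasiperfect →
    QuasiperfectSquare.∃-no-divisor≡5 p a N m p-prime p-injective a>0 N≡∏ N≡m² N-quasiperfect) ,
  (λ t p a N m p-prime p-injective a>0 N≡∏^ N≡m² N-quasiperfect →
    let open QuasiperfectPower p a N m p-prime p-injective a>0 N≡∏^ N≡m² N-quasiperfect
    in prime∣N-mod-8 , (proj₂ pⱼ≡1×2a+1≡3 , λ q _ → ∣2a+1⇒oneOrThree) , 3∣2a+1)
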